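{- There is an absolute constant $K>0$ such that for every $n\ge 1$, every $f:\{0,1\}^n\to\{0,1\}$, every $\epsilon\in[0,1/2)$ and every product distribution $\mu$ on $\{0,1\}^n$, $$D^{\mu}_{4\epsilon}(f)\le K\cdot \mathrm{corr}_{\epsilon}(f)^2 .$$
   Context: Let $f:\{0,1\}^n\to\{0,1\}$ and $[n]=\{1,\dots,n\}$. Distributional query complexity: for a probability distribution $\mu$ on $\{0,1\}^n$ and $\delta\ge 0$, $D^\mu_\delta(f)$ is the minimum, over deterministic query algorithms (decision trees) $\mathcal A$ with $\Pr_{x\sim\mu}[\mathcal A(x)=f(x)]\ge 1-\delta$, of the worst-case (over inputs $x$) number of queried bits of $x$. A product distribution on $\{0,1\}^n$ is a distribution of the form $\mu(x)=\prod_{i\in[n]}\mu_i(x_i)$ with $\mu_i:\{0,1\}\to[0,1]$, $\mu_i(0)+\mu_i(1)=1$. Assignments: an assignment is a map $A:[n]\to\{0,1,*\}$, identified with the subcube $\{x: \forall i,\ x_i=A(i)\text{ or }A(i)=*\}$; $|A|=|\{i:A(i)\ne *\}|$ is its co-dimension. Corruption: for a distribution $\nu$ on $\{0,1\}^n$, $\epsilon\ge 0$ and $b\in\{0,1\}$, an assignment $A$ is an $\epsilon$-error $b$-certificate under $\nu$ if $\Pr_{x\sim\nu}[x\in A]>0$ and $\Pr_{x\sim\nu}[f(x)\ne b\mid x\in A]\le\epsilon$. Let $\mathrm{corr}^{b,\nu}_\epsilon(f)$ be the minimum of $|A|$ over $\epsilon$-error $b$-certificates $A$ under $\nu$. The query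 corruption bound is $\mathrm{corr}_\epsilon(f)=\max_{\nu}\max_{b}\mathrm{corr}^{b,\nu}_\epsilon(f)$, where $\nu$ ranges over all probability distributions on $\{0,1\}^n$ and $b\in\{0,1\}$, the maximum being taken over those pairs $(\nu,b)$ for which an $\epsilon$-error $b$-certificate under $\nu$ exists. -}

module Defs where

open import Level using (Level; suc; _⊔_)
open import Algebra.Bundles using (CommutativeRing)
import Algebra.Definitions.RawMonoid as RawMonoidDefs
open import Data.Bool using (Bool; true; false; if_then_else_)
open import Data.Bool.Properties using () renaming (_≟_ to _≟ᵇ_)
open import Data.Fin using (Fin)
open import Data.Fin.Properties using (all?)
open import Data.Maybe using (Maybe; just; nothing)
open import Data.Maybe.Properties using (≡-dec)
import Data.Maybe.Relation.Unary.Any as MaybeAny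
open import Data.Nat as ℕ using (ℕ)
open import Data.Product using (Σ-syntax; ∃-syntax; _×_; _,_)
open import Data.Sum using (_⊎_)
open import Data.Unit using (tt)
open import Data.Vec using (Vec; []; _∷_; lookup; count)
open import Function using (_∘_)
open import Relation.Binary using (Rel; IsDecTotalOrder)
open import Relation.Binary.PropositionalEquality using (_≡_)
open import Relation.Nullary using (¬_; Dec; does; yes; ¬?)
open import Relation.Nullary.Decidable using (_⊎-dec_; _×-dec_)
open import Relation.Unary using (Pred; Decidable)

-- The real numbers enter only through these axioms (ordered field with a
-- classically total, decidable order): results are stated for every such
-- field, the classical reals among them.
record OrderedField (c ℓ₁ ℓ₂ : Level) : Set (suc (c ⊔ ℓ₁ ⊔ ℓ₂)) where
  infix 4 _≤_ _<_
  field
    commutativeRing : CommutativeRing c ℓ₁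
  open CommutativeRing commutativeRing public
  field
    _≤_             : Rel Carrier ℓ₂
    isDecTotalOrder : IsDecTotalOrder _≈_ _≤_
    +-monoʳ-≤       : ∀ x {y z} → y ≤ z → x + y ≤ x + z
    *-nonNeg        : ∀ {x y} → 0# ≤ x → 0# ≤ y → 0# ≤ x * y
    0≉1             : ¬ 0# ≈ 1#
    inv             : ∀ x → ¬ 0# ≈ x → Carrier
    *-inverseʳ      : ∀ x (0≉x : ¬ 0# ≈ x) → x * inv x 0≉x ≈ 1#

  _<_ : Rel Carrier (ℓ₁ ⊔ ℓ₂)
  x < y = x ≤ y × ¬ x ≈ y

  open RawMonoidDefs +-rawMonoid public using () renaming (_×_ to _·_)
  open RawMonoidDefs *-rawMonoid public using () renaming (sum to ∏)

IsMin IsMax : ∀ {p} → Pred ℕ p → Pred ℕ p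
IsMin P m = P m × (∀ k → P k → m ℕ.≤ k)
IsMax P m = P m × (∀ k → P k → k ℕ.≤ m)

Cube : ℕ → Set
Cube n = Vec Bool n

foldCube : ∀ {a} {A : Set a} → (A → A → A) → ∀ {n} → (Cube n → A) → A
foldCube _∙_ {ℕ.zero}  g = g []
foldCube _∙_ {ℕ.suc n} g =
  foldCube _∙_ (g ∘ (false ∷_)) ∙ foldCube _∙_ (g ∘ (true ∷_))

data DecisionTree (n : ℕ) : Set where
  leaf  : Bool → DecisionTree n
  query : Fin n → (if0 if1 : DecisionTree n) → DecisionTree n

run : ∀ {n} → DecisionTree n → Cube n → Bool
run (leaf b)          x = b
run (query i if0 if1) x = if lookup x i then run if1 x else run if0 x

-- Querying a bit again is counted again; this does not affect the minimum
-- over trees.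
queries : ∀ {n} → DecisionTree n → Cube n → ℕ
queries (leaf b)          x = 0
queries (query i if0 if1) x =
  ℕ.suc (if lookup x i then queries if1 x else queries if0 x)

worstCase : ∀ {n} → DecisionTree n → ℕ
worstCase t = foldCube ℕ._⊔_ (queries t)

-- nothing plays the role of *.
Assignment : ℕ → Set
Assignment n = Vec (Maybe Bool) n

infix 4 _∈_ _∈?_

_∈_ : ∀ {n} → Cube n → Assignment n → Set
x ∈ A = ∀ i → just (lookup x i) ≡ lookup A i ⊎ lookup A i ≡ nothing

_∈?_ : ∀ {n} (x : Cube n) (A : Assignment n) → Dec (x ∈ A)
x ∈? A = all? λ i →
  ≡-dec _≟ᵇ_ (just (lookup x i)) (lookup A i) ⊎-dec
  ≡-dec _≟ᵇ_ (lookup A i) nothing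

codim : ∀ {n} → Assignment n → ℕ
codim = count (MaybeAny.dec λ _ → yes tt)

module QueryComplexity {c ℓ₁ ℓ₂} (F : OrderedField c ℓ₁ ℓ₂) where
  open OrderedField F

  ∑ : ∀ {n} → (Cube n → Carrier) → Carrier
  ∑ = foldCube _+_

  record Distribution (n : ℕ) : Set (c ⊔ ℓ₁ ⊔ ℓ₂) where
    field
      mass   : Cube n → Carrier
      nonNeg : ∀ x → 0# ≤ mass x
      total  : ∑ mass ≈ 1#
  open Distribution public

  IsProduct : ∀ {n} → Distribution n → Set (c ⊔ ℓ₁ ⊔ ℓ₂)
  IsProduct {n} μ = Σ[ m ∈ (Fin n → Bool → Carrier) ]
    (∀ i b → 0# ≤ m i b × m i b ≤ 1#) ×
    (∀ i → m i false + m i true ≈ 1#) ×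
    (∀ x → mass μ x ≈ ∏ λ i → m i (lookup x i))

  Pr : ∀ {n p} {E : Pred (Cube n) p} → Distribution n → Decidable E → Carrier
  Pr μ E? = ∑ λ x → if does (E? x) then mass μ x else 0#

  Pr[_∣_] : ∀ {n p q} {E : Pred (Cube n) p} {G : Pred (Cube n) q} →
            Decidable E → (G? : Decidable G) (μ : Distribution n) →
            0# < Pr μ G? → Carrier
  Pr[ E? ∣ G? ] μ (_ , 0≉PrG) =
    Pr μ (λ x → E? x ×-dec G? x) * inv (Pr μ G?) 0≉PrG

  module _ {n : ℕ} (f : Cube n → Bool) where

    -- IsD μ δ d means D^μ_δ(f) = d.
    IsD : Distribution n → Carrier → ℕ → Set ℓ₂
    IsD μ δ = IsMin λ d → ∃[ t ]
      1# - δ ≤ Pr μ (λ x → run t x ≟ᵇ f x) × worstCase t ≡ d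

    IsCertificate : Carrier → Bool → Distribution n → Assignment n →
                    Set (ℓ₁ ⊔ ℓ₂)
    IsCertificate ε b ν A = Σ[ pos ∈ 0# < Pr ν (_∈? A) ]
      Pr[ (λ x → ¬? (f x ≟ᵇ b)) ∣ (_∈? A) ] ν pos ≤ ε

    -- IsCorrAt ε b ν k means corr^{b,ν}_ε(f) = k.
    IsCorrAt : Carrier → Bool → Distribution n → ℕ → Set (ℓ₁ ⊔ ℓ₂)
    IsCorrAt ε b ν = IsMin λ k → ∃[ A ] IsCertificate ε b ν A × codim A ≡ k

    -- IsCorr ε k means corr_ε(f) = k.  A pair (b , ν) without certificates
    -- satisfies IsCorrAt for no value, hence is left out of the maximum.
    IsCorr : Carrier → ℕ → Set (c ⊔ ℓ₁ ⊔ ℓ₂)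
    IsCorr ε = IsMax λ k → ∃[ ν ] ∃[ b ] IsCorrAt ε b ν k

{-# OPTIONS --safe #-}
module Submission where

-- The corruption bound dominates certificate complexity: for a point x, let ν be
-- uniform on {x} ∪ {y | f y ≠ f x}. A subcube that meets the support of ν and
-- contains some y with f y ≠ f x has only x as a point of the right value, if any, so
-- its conditional error is at least 1/2 > ε. Hence the ε-error certificates for
-- f x under ν are exactly the subcubes through x on which f is constant, and x
-- has a certificate of size at most k. The classical algorithm, which repeatedly
-- queries a 1-certificate consistent with the answers so far, then computes f
-- without error in k² queries, because every 0-certificate meets every
-- 1-certificate and so loses a coordinate in each of at most k rounds.

open import Defs
open import Level using (0ℓ)
open import Data.Bool using (Bool; true; false; if_then_else_; _∧_; _∨_)
open import Data.Bool.Properties using (¬-not) renaming (_≟_ to _≟ᵇ_)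
open import Data.Fin.Properties using (all?) renaming (_≟_ to _≟ᶠ_)
open import Data.Fin.Subset as Subset using (Subset; ∣_∣; Nonempty; _∩_; _─_; ⊤)
open import Data.Fin.Subset.Properties as Subsetₚ using (anySubset?; nonempty?)
open import Data.Maybe using (just; nothing; is-just)
open import Data.Maybe.Properties using (just-injective)
open import Data.Nat as ℕ using (ℕ; zero; suc; s≤s; z≤n)
import Data.Nat.Properties as ℕₚ
import Algebra.Properties.Ring as RingProperties
import Relation.Binary.Reasoning.PartialOrder as PosetReasoning
open import Data.Nat.Induction using (<-rec)
open import Data.Product using (Σ-syntax; ∃-syntax; _×_; _,_; proj₁; proj₂)
open import Data.Sum using (_⊎_; inj₁; inj₂)
open import Data.Vec using ([]; _∷_; lookup; map; zipWith; tabulate; replicate; _[_]≔_)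
open import Data.Vec.Properties using (≡-dec; lookup∘tabulate; tabulate∘lookup; tabulate-cong; lookup-map; lookup-zipWith;
  lookup∘update; lookup∘update′; []=⇒lookup; lookup⇒[]=)
open import Function using (_∘_)
open import Relation.Binary using (Poset; IsDecTotalOrder)
open import Relation.Binary.PropositionalEquality as ≡ using (_≡_; _≢_; cong)
open import Relation.Nullary using (¬_; Dec; yes; no; does; contradiction; ¬?)
open import Relation.Nullary.Decidable using (_×-dec_; _⊎-dec_; _→-dec_; dec-true; decidable-stable)
open import Relation.Unary using (Pred; Decidable; U)

-- Agreement on coordinate sets and splicing.

infix 4 _≈[_]_ _≈[_]?_

_≈[_]_ : ∀ {n} → Cube n → Subset n → Cube n → Set
x ≈[ S ] y = ∀ i → i Subset.∈ S → lookup x i ≡ lookup y i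

_≈[_]?_ : ∀ {n} (x : Cube n) (S : Subset n) (y : Cube n) → Dec (x ≈[ S ] y)
x ≈[ S ]? y = all? λ i → (i Subsetₚ.∈? S) →-dec (lookup x i ≟ᵇ lookup y i)

splice : ∀ {n} → Subset n → Cube n → Cube n → Cube n
splice S x y = tabulate λ i → if lookup S i then lookup x i else lookup y i

splice-∈ : ∀ {n} (S : Subset n) x y → splice S x y ≈[ S ] x
splice-∈ S x y i i∈S
  rewrite lookup∘tabulate (λ j → if lookup S j then lookup x j else lookup y j) i
        | []=⇒lookup i∈S = ≡.refl

splice-∉ : ∀ {n} (S : Subset n) x y i → ¬ i Subset.∈ S →
           lookup (splice S x y) i ≡ lookup y i
splice-∉ S x y i i∉S
  rewrite lookup∘tabulate (λ j → if lookup S j then lookup x j else lookup y j) i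
        | ¬-not (i∉S ∘ lookup⇒[]= i S) = ≡.refl

-- The nonempty sets with this property are the subcubes. This is the form in which the meeting
-- argument uses that the answers so far define a subcube.
SpliceClosed : ∀ {n} → Pred (Cube n) 0ℓ → Set
SpliceClosed P = ∀ S x y → P x → P y → P (splice S x y)

splice-≈ : ∀ {n} {T : Subset n} {z} → SpliceClosed (_≈[ T ] z)
splice-≈ S x y x≈z y≈z i i∈T with i Subsetₚ.∈? S
... | yes i∈S = ≡.trans (splice-∈ S x y i i∈S) (x≈z i i∈T)
... | no  i∉S = ≡.trans (splice-∉ S x y i i∉S) (y≈z i i∈T)

-- `IsCorrAt` asks for an attained minimum, so a smallest certificate must be exhibited. Strong
-- induction on the size: as long as the finite search finds a smaller set with `P`, move to it.
min-subset : ∀ {n} {P : Pred (Subset n) 0ℓ} → Decidable P → (∃[ S ] P S) →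
             ∃[ S ] P S × (∀ T → P T → ∣ S ∣ ℕ.≤ ∣ T ∣)
min-subset {n} {P} P? (S₀ , PS₀) =
  <-rec (λ m → ∀ S → P S → ∣ S ∣ ≡ m → _) search ∣ S₀ ∣ S₀ PS₀ ≡.refl
  where
  search : ∀ m → (∀ {l} → l ℕ.< m → ∀ S → P S → ∣ S ∣ ≡ l →
                  ∃[ S ] P S × (∀ T → P T → ∣ S ∣ ℕ.≤ ∣ T ∣)) →
           ∀ S → P S → ∣ S ∣ ≡ m → ∃[ S ] P S × (∀ T → P T → ∣ S ∣ ℕ.≤ ∣ T ∣)
  search _ rec S PS ≡.refl with anySubset? (λ T → P? T ×-dec (∣ T ∣ ℕ.<? ∣ S ∣))
  ... | yes (T , PT , T<S) = rec T<S T PT ≡.refl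
  ... | no  none = S , PS , λ T PT → ℕₚ.≮⇒≥ λ T<S → none (T , PT , T<S)

worstCase-≤ : ∀ {n d} (t : DecisionTree n) → (∀ x → queries t x ℕ.≤ d) → worstCase t ℕ.≤ d
worstCase-≤ {d = d} t = go (queries t)
  where
  go : ∀ {m} (g : Cube m → ℕ) → (∀ x → g x ℕ.≤ d) → foldCube ℕ._⊔_ g ℕ.≤ d
  go {zero}  g g≤d = g≤d []
  go {suc m} g g≤d = ℕₚ.⊔-lub (go (g ∘ (false ∷_)) (g≤d ∘ (false ∷_)))
                              (go (g ∘ (true ∷_)) (g≤d ∘ (true ∷_)))

-- Certificates and the decision tree built from them.

module _ {n : ℕ} (f : Cube n → Bool) where

  -- A certificate is stored as its set of coordinates; the values are those of `x`. Shrinking and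
  -- intersecting certificates then become operations on `Subset`.
  Certifies : Subset n → Cube n → Set
  Certifies S x = ∀ y → y ≈[ S ] x → f y ≡ f x

  certifies? : ∀ x → Decidable λ S → Certifies S x
  -- Inputs and coordinate sets are both Boolean vectors of length `n`, so `anySubset?` also
  -- searches over inputs `y`.
  certifies? x S with anySubset? (λ y → (y ≈[ S ]? x) ×-dec ¬? (f y ≟ᵇ f x))
  ... | yes (y , y≈x , fy≢fx) = no λ cert → fy≢fx (cert y y≈x)
  ... | no  none = yes λ y y≈x →
    decidable-stable (f y ≟ᵇ f x) λ fy≢fx → none (y , y≈x , fy≢fx)

  ⊤-certifies : ∀ x → Certifies ⊤ x
  ⊤-certifies x y y≈x = cong f (begin
    y                   ≡⟨ tabulate∘lookup y ⟨
    tabulate (lookup y) ≡⟨ tabulate-cong (λ i → y≈x i Subsetₚ.∈⊤) ⟩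
    tabulate (lookup x) ≡⟨ tabulate∘lookup x ⟩
    x                   ∎)
    where open ≡.≡-Reasoning

  -- `P` collects the inputs consistent with the answers so far; elsewhere the tree may do anything.
  Computable : Pred (Cube n) 0ℓ → ℕ → Set
  Computable P d = ∃[ t ] ∀ x → P x → run t x ≡ f x × queries t x ℕ.≤ d

  query-computable : ∀ {P d} i → (∀ b → Computable (λ x → P x × lookup x i ≡ b) d) →
                     Computable P (suc d)
  query-computable {P} {d} i h = query i (proj₁ (h false)) (proj₁ (h true)) , correct
    where
    correct : ∀ x → P x →
              run (query i (proj₁ (h false)) (proj₁ (h true))) x ≡ f x ×
              queries (query i (proj₁ (h false)) (proj₁ (h true))) x ℕ.≤ suc d
    correct x Px with lookup x i in eq
    ... | false = let r , q = proj₂ (h false) x (Px , eq) in r , s≤s q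
    ... | true  = let r , q = proj₂ (h true) x (Px , eq) in r , s≤s q

  -- The recursion runs on the budget `s`, since the next coordinate is whichever one `nonempty?`
  -- returns. The continuation may depend on all answers, which are recorded in `z`.
  queryAll-computable : ∀ {P d} s S → ∣ S ∣ ℕ.≤ s →
    (∀ z → Computable (λ x → P x × x ≈[ S ] z) d) → Computable P (s ℕ.+ d)
  queryAll-computable s S ∣S∣≤s h with nonempty? S
  queryAll-computable {d = d} s S ∣S∣≤s h | no empty =
    let t , correct = h (replicate n false)
    in t , λ x Px →
      let r , q = correct x (Px , λ i i∈S → contradiction (i , i∈S) empty)
      in r , ℕₚ.≤-trans q (ℕₚ.m≤n+m d s)
  queryAll-computable zero S ∣S∣≤0 h | yes (i , i∈S) =
    contradiction (ℕₚ.<-≤-trans (Subsetₚ.x∈p⇒∣p-x∣<∣p∣ i∈S) ∣S∣≤0) λ ()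
  queryAll-computable {P} {d} (suc s) S ∣S∣≤1+s h | yes (i , i∈S) =
    query-computable i λ b → queryAll-computable s (S Subset.- i)
      (ℕₚ.≤-pred (ℕₚ.<-≤-trans (Subsetₚ.x∈p⇒∣p-x∣<∣p∣ i∈S) ∣S∣≤1+s)) λ z →
        -- The answer `b` is written into `z` at position `i`; the other coordinates of `S` come
        -- from the recursive call.
        let t , correct = h (z [ i ]≔ b)
        in t , λ { x ((Px , xᵢ≡b) , x≈z) → correct x (Px , extend x z xᵢ≡b x≈z) }
    where
    extend : ∀ x z {b} → lookup x i ≡ b → x ≈[ S Subset.- i ] z → x ≈[ S ] z [ i ]≔ b
    extend x z {b} xᵢ≡b x≈z j j∈S with j ≟ᶠ i
    ... | yes ≡.refl = ≡.trans xᵢ≡b (≡.sym (lookup∘update i z b))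
    ... | no  j≢i = ≡.trans (x≈z j (Subsetₚ.x∈p∧x≢y⇒x∈p-y j∈S j≢i))
                            (≡.sym (lookup∘update′ j≢i z b))

  -- Soundness is asked only against inputs in `P`; this relativity lets coordinates already queried
  -- be dropped from the certificates.
  ZeroCertified : Pred (Cube n) 0ℓ → ℕ → Set
  ZeroCertified P j = ∀ y → P y → f y ≡ false →
    ∃[ S ] ∣ S ∣ ℕ.≤ j × (∀ w → P w → w ≈[ S ] y → f w ≡ false)

  -- Otherwise splicing y and x along S would give an input carrying both certificates.
  certificates-meet : ∀ {P x y S T} → SpliceClosed P → P x → P y → f x ≡ true →
    Certifies T x → (∀ w → P w → w ≈[ S ] y → f w ≡ false) → Nonempty (S ∩ T)
  certificates-meet {P} {x} {y} {S} {T} closed Px Py fx≡1 one zero-cert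
    with nonempty? (S ∩ T)
  ... | yes meet = meet
  ... | no  disjoint = contradiction
    (≡.trans (≡.sym (zero-cert w (closed S y x Py Px) (splice-∈ S y x)))
             (≡.trans (one w λ i i∈T → splice-∉ S y x i λ i∈S →
                        disjoint (i , Subsetₚ.x∈p∩q⁺ (i∈S , i∈T)))
                      fx≡1))
    λ ()
    where
    w = splice S y x

  -- Querying a 1-certificate T shortens every surviving 0-certificate.
  computable : ∀ {k} j {P} → Decidable P → SpliceClosed P →
    (∀ x → ∃[ T ] ∣ T ∣ ℕ.≤ k × Certifies T x) → ZeroCertified P j →
    Computable P (j ℕ.* k)
  computable j P? closed ones zeros with anySubset? (λ x → P? x ×-dec (f x ≟ᵇ true))
  computable j P? closed ones zeros | no none =
    leaf false , λ x Px → ≡.sym (¬-not λ fx≡1 → none (x , Px , fx≡1)) , z≤n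
  computable zero P? closed ones zeros | yes (x , Px , fx≡1) =
    -- An empty 0-certificate cannot meet the 1-certificate of `x`, so no 0-input is left in `P`.
    leaf true , λ y Py → ≡.sym (¬-not λ fy≡0 →
      let T , _ , one = ones x
          S , ∣S∣≤0 , zero-cert = zeros y Py fy≡0
          meet = certificates-meet closed Px Py fx≡1 one zero-cert
      in contradiction (ℕₚ.<-≤-trans (Subsetₚ.p∩q≢∅⇒∣p─q∣<∣p∣ S T meet) ∣S∣≤0) λ ()) , z≤n
  computable (suc j) {P} P? closed ones zeros | yes (x , Px , fx≡1) with ones x
  -- Querying `T` costs `k` and the rest `j * k`; the sum is `suc j * k` by definition.
  ... | T , ∣T∣≤k , one = queryAll-computable _ T ∣T∣≤k λ z →
    computable j (λ y → P? y ×-dec (y ≈[ T ]? z))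
      (λ { S u v (Pu , u≈z) (Pv , v≈z) → closed S u v Pu Pv , splice-≈ {z = z} S u v u≈z v≈z })
      ones (shorten z)
    where
    shorten : ∀ z → ZeroCertified (λ y → P y × y ≈[ T ] z) j
    shorten z y (Py , y≈z) fy≡0 with zeros y Py fy≡0
    ... | S , ∣S∣≤1+j , zero-cert =
      -- On `T` every surviving `w` agrees with `y`, because both agree with `z`; so only the
      -- coordinates in `S ─ T` still have to be fixed. This set is smaller since `S` and `T` meet.
      S ─ T ,
      ℕₚ.≤-pred (ℕₚ.<-≤-trans (Subsetₚ.p∩q≢∅⇒∣p─q∣<∣p∣ S T
        (certificates-meet closed Px Py fx≡1 one zero-cert)) ∣S∣≤1+j) ,
      λ { w (Pw , w≈z) w≈y → zero-cert w Pw λ i i∈S → agree w w≈z w≈y i i∈S }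
      where
      agree : ∀ w → w ≈[ T ] z → w ≈[ S ─ T ] y → w ≈[ S ] y
      agree w w≈z w≈y i i∈S with i Subsetₚ.∈? T
      ... | yes i∈T = ≡.trans (w≈z i i∈T) (≡.sym (y≈z i i∈T))
      ... | no  i∉T = w≈y i (Subsetₚ.x∈p∧x∉q⇒x∈p─q i∈S i∉T)

  -- Start from the whole cube: 0-certificates have size at most `k`, so at most `k` rounds of `k`
  -- queries occur.
  certificates⇒tree : ∀ {k} → (∀ x → ∃[ S ] ∣ S ∣ ℕ.≤ k × Certifies S x) →
    ∃[ t ] (∀ x → run t x ≡ f x) × worstCase t ℕ.≤ k ℕ.* k
  certificates⇒tree {k} certs =
    let t , correct = computable k {U} (λ _ → yes _) (λ _ _ _ _ _ → _) certs
          λ y _ fy≡0 → let S , ∣S∣≤k , cert = certs y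
                       in S , ∣S∣≤k , λ w _ w≈y → ≡.trans (cert w w≈y) fy≡0
    in t , (λ x → proj₁ (correct x _)) , worstCase-≤ t λ x → proj₂ (correct x _)

-- Coordinate sets versus assignments.

restrict : ∀ {n} → Cube n → Subset n → Assignment n
restrict = zipWith λ b s → if s then just b else nothing

codim-restrict : ∀ {n} (x : Cube n) S → codim (restrict x S) ≡ ∣ S ∣
codim-restrict []      []          = ≡.refl
codim-restrict (b ∷ x) (true ∷ S)  = cong suc (codim-restrict x S)
codim-restrict (b ∷ x) (false ∷ S) = codim-restrict x S

∈-restrict⁺ : ∀ {n} (x y : Cube n) S → y ≈[ S ] x → y ∈ restrict x S
∈-restrict⁺ x y S y≈x i
  rewrite lookup-zipWith (λ b s → if s then just b else nothing) i x S
  with lookup S i in eq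
... | true  = inj₁ (cong just (y≈x i (lookup⇒[]= i S eq)))
... | false = inj₂ ≡.refl

∈-restrict⁻ : ∀ {n} (x y : Cube n) S → y ∈ restrict x S → y ≈[ S ] x
∈-restrict⁻ x y S y∈ i i∈S with y∈ i
... | y∈ᵢ rewrite lookup-zipWith (λ b s → if s then just b else nothing) i x S
                | []=⇒lookup i∈S with y∈ᵢ
...   | inj₁ eq = just-injective eq

support : ∀ {n} → Assignment n → Subset n
support = map is-just

∣support∣ : ∀ {n} (A : Assignment n) → ∣ support A ∣ ≡ codim A
∣support∣ []            = ≡.refl
∣support∣ (just _ ∷ A)  = cong suc (∣support∣ A)
∣support∣ (nothing ∷ A) = ∣support∣ A

∈-resp-support : ∀ {n} (x y : Cube n) A → x ∈ A → y ≈[ support A ] x → y ∈ A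
∈-resp-support x y A x∈A y≈x i with x∈A i
... | inj₂ eq = inj₂ eq
... | inj₁ eq = inj₁ (≡.trans (cong just (y≈x i (lookup⇒[]= i (support A)
  (≡.trans (lookup-map i is-just A) (cong is-just (≡.sym eq)))))) eq)

-- Ordered field arithmetic.

module OrderedFieldProperties {c ℓ₁ ℓ₂} (F : OrderedField c ℓ₁ ℓ₂) where
  open OrderedField F
  open IsDecTotalOrder isDecTotalOrder public
    using (antisym; total) renaming (refl to ≤-refl; trans to ≤-trans; reflexive to ≤-reflexive)
  open RingProperties ring

  poset : Poset c ℓ₁ ℓ₂
  poset = record { isPartialOrder = IsDecTotalOrder.isPartialOrder isDecTotalOrder }

  open PosetReasoning poset

  +-mono-≤ : ∀ {w x y z} → w ≤ x → y ≤ z → w + y ≤ x + z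
  +-mono-≤ {w} {x} {y} {z} w≤x y≤z = begin
    w + y ≤⟨ +-monoʳ-≤ w y≤z ⟩
    w + z ≈⟨ +-comm w z ⟩
    z + w ≤⟨ +-monoʳ-≤ z w≤x ⟩
    z + x ≈⟨ +-comm z x ⟩
    x + z ∎

  x≤x+y : ∀ {x y} → 0# ≤ y → x ≤ x + y
  x≤x+y {x} {y} 0≤y = begin
    x      ≈⟨ +-identityʳ x ⟨
    x + 0# ≤⟨ +-monoʳ-≤ x 0≤y ⟩
    x + y  ∎

  x≤y+x : ∀ {x y} → 0# ≤ y → x ≤ y + x
  x≤y+x {x} {y} 0≤y = ≤-trans (x≤x+y 0≤y) (≤-reflexive (+-comm x y))

  x≤y⇒0≤y-x : ∀ {x y} → x ≤ y → 0# ≤ y - x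
  x≤y⇒0≤y-x {x} {y} x≤y = begin
    0#      ≈⟨ -‿inverseˡ x ⟨
    - x + x ≤⟨ +-monoʳ-≤ (- x) x≤y ⟩
    - x + y ≈⟨ +-comm (- x) y ⟩
    y - x   ∎

  x≤0⇒0≤-x : ∀ {x} → x ≤ 0# → 0# ≤ - x
  x≤0⇒0≤-x {x} x≤0 = ≤-trans (x≤y⇒0≤y-x x≤0) (≤-reflexive (+-identityˡ (- x)))

  0≤y-x⇒x≤y : ∀ {x y} → 0# ≤ y - x → x ≤ y
  0≤y-x⇒x≤y {x} {y} 0≤y-x = begin
    x             ≤⟨ x≤x+y 0≤y-x ⟩
    x + (y - x)   ≈⟨ +-congˡ (+-comm y (- x)) ⟩
    x + (- x + y) ≈⟨ +-assoc x (- x) y ⟨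
    x - x + y     ≈⟨ +-congʳ (-‿inverseʳ x) ⟩
    0# + y        ≈⟨ +-identityˡ y ⟩
    y             ∎

  x-y≤x : ∀ {x y} → 0# ≤ y → x - y ≤ x
  x-y≤x {x} {y} 0≤y = begin
    x - y         ≤⟨ x≤x+y 0≤y ⟩
    x - y + y     ≈⟨ +-assoc x (- y) y ⟩
    x + (- y + y) ≈⟨ +-congˡ (-‿inverseˡ y) ⟩
    x + 0#        ≈⟨ +-identityʳ x ⟩
    x             ∎

  *-monoʳ-≤ : ∀ {x y z} → 0# ≤ z → x ≤ y → x * z ≤ y * z
  *-monoʳ-≤ {x} {y} {z} 0≤z x≤y = 0≤y-x⇒x≤y (begin
    0#            ≤⟨ *-nonNeg (x≤y⇒0≤y-x x≤y) 0≤z ⟩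
    (y - x) * z   ≈⟨ [y-z]x≈yx-zx z y x ⟩
    y * z - x * z ∎)

  0≤1 : 0# ≤ 1#
  0≤1 with total 0# 1#
  ... | inj₁ 0≤1 = 0≤1
  ... | inj₂ 1≤0 = begin
    0#            ≤⟨ *-nonNeg (x≤0⇒0≤-x 1≤0) (x≤0⇒0≤-x 1≤0) ⟩
    - 1# * - 1#   ≈⟨ -1*x≈-x (- 1#) ⟩
    - - 1#        ≈⟨ -‿involutive 1# ⟩
    1#            ∎

  <-≤-trans : ∀ {x y z} → x < y → y ≤ z → x < z
  <-≤-trans (x≤y , x≉y) y≤z = ≤-trans x≤y y≤z , λ x≈z →
    x≉y (antisym x≤y (≤-trans y≤z (≤-reflexive (sym x≈z))))

  <⇒≱ : ∀ {x y} → x < y → ¬ y ≤ x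
  <⇒≱ (x≤y , x≉y) y≤x = x≉y (antisym x≤y y≤x)

  inv-nonNeg : ∀ {x} → 0# ≤ x → (0≉x : ¬ 0# ≈ x) → 0# ≤ inv x 0≉x
  inv-nonNeg {x} 0≤x 0≉x with total 0# (inv x 0≉x)
  ... | inj₁ 0≤i = 0≤i
  -- A nonpositive inverse would give `0# ≤ - 1#`, hence `1# ≤ 0#`, and antisymmetry then gives
  -- `0# ≈ 1#`.
  ... | inj₂ i≤0 = contradiction (antisym 0≤1 (0≤y-x⇒x≤y (begin
    0#                ≤⟨ *-nonNeg 0≤x (x≤0⇒0≤-x i≤0) ⟩
    x * - inv x 0≉x   ≈⟨ -‿distribʳ-* x _ ⟨
    - (x * inv x 0≉x) ≈⟨ -‿cong (*-inverseʳ x 0≉x) ⟩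
    - 1#              ≈⟨ +-identityˡ (- 1#) ⟨
    0# - 1#           ∎))) 0≉1

  inv-pos : ∀ {x} → 0# ≤ x → (0≉x : ¬ 0# ≈ x) → 0# < inv x 0≉x
  inv-pos {x} 0≤x 0≉x = inv-nonNeg 0≤x 0≉x , λ 0≈i → 0≉1 (begin-equality
    0#           ≈⟨ zeroʳ x ⟨
    x * 0#       ≈⟨ *-congˡ 0≈i ⟩
    x * inv x 0≉x ≈⟨ *-inverseʳ x 0≉x ⟩
    1#           ∎)

  ·-nonNeg : ∀ n {x} → 0# ≤ x → 0# ≤ n · x
  ·-nonNeg zero    0≤x = ≤-refl
  ·-nonNeg (suc n) 0≤x = ≤-trans (·-nonNeg n 0≤x) (x≤y+x 0≤x)

  x+x≈2·x : ∀ x → x + x ≈ 2 · x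
  x+x≈2·x x = +-congˡ (sym (+-identityʳ x))

  if-nonNeg : ∀ b {x} → 0# ≤ x → 0# ≤ (if b then x else 0#)
  if-nonNeg true  0≤x = 0≤x
  if-nonNeg false 0≤x = ≤-refl

  if-≈0 : ∀ {p} {P : Set p} (P? : Dec P) {x} → (P → x ≈ 0#) →
          (if does P? then x else 0#) ≈ 0#
  if-≈0 (yes p) x≈0 = x≈0 p
  if-≈0 (no _)  x≈0 = refl

-- Sums over the cube.

module SumProperties {c ℓ₁ ℓ₂} (F : OrderedField c ℓ₁ ℓ₂) where
  open OrderedField F
  open QueryComplexity F using (∑)
  open OrderedFieldProperties F
  open import Algebra.Properties.CommutativeSemigroup +-commutativeSemigroup using (interchange)
  open PosetReasoning poset

  ∑-mono : ∀ {n} {g h : Cube n → Carrier} → (∀ x → g x ≤ h x) → ∑ g ≤ ∑ h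
  ∑-mono {zero}  g≤h = g≤h []
  ∑-mono {suc n} g≤h = +-mono-≤ (∑-mono (g≤h ∘ (false ∷_))) (∑-mono (g≤h ∘ (true ∷_)))

  ∑-cong : ∀ {n} {g h : Cube n → Carrier} → (∀ x → g x ≈ h x) → ∑ g ≈ ∑ h
  ∑-cong {zero}  g≈h = g≈h []
  ∑-cong {suc n} g≈h = +-cong (∑-cong (g≈h ∘ (false ∷_))) (∑-cong (g≈h ∘ (true ∷_)))

  ∑-zero : ∀ {n} {g : Cube n → Carrier} → (∀ x → g x ≈ 0#) → ∑ g ≈ 0#
  ∑-zero {zero}  g≈0 = g≈0 []
  ∑-zero {suc n} g≈0 = trans
    (+-cong (∑-zero (g≈0 ∘ (false ∷_))) (∑-zero (g≈0 ∘ (true ∷_)))) (+-identityˡ 0#)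

  ∑-distrib-+ : ∀ {n} (g h : Cube n → Carrier) → ∑ (λ x → g x + h x) ≈ ∑ g + ∑ h
  ∑-distrib-+ {zero}  g h = refl
  ∑-distrib-+ {suc n} g h = trans
    (+-cong (∑-distrib-+ (g ∘ (false ∷_)) (h ∘ (false ∷_)))
            (∑-distrib-+ (g ∘ (true ∷_)) (h ∘ (true ∷_))))
    (interchange _ _ _ _)

  ∑-distribʳ-* : ∀ {n} (g : Cube n → Carrier) v → ∑ (λ x → g x * v) ≈ ∑ g * v
  ∑-distribʳ-* {zero}  g v = refl
  ∑-distribʳ-* {suc n} g v = trans
    (+-cong (∑-distribʳ-* (g ∘ (false ∷_)) v) (∑-distribʳ-* (g ∘ (true ∷_)) v))
    (sym (distribʳ v _ _))

  ∑-singleton : ∀ {n} (x : Cube n) v →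
    ∑ (λ y → if does (≡-dec _≟ᵇ_ y x) then v else 0#) ≈ v
  ∑-singleton []          v = refl
  -- Unequal heads already make `does` compute to `false`, so the summands in the other half are
  -- literally `0#`.
  ∑-singleton {suc n} (false ∷ x) v = trans
    (+-cong (∑-singleton x v) (∑-zero {n} λ _ → refl)) (+-identityʳ v)
  ∑-singleton {suc n} (true ∷ x)  v = trans
    (+-cong (∑-zero {n} λ _ → refl) (∑-singleton x v)) (+-identityˡ v)

  summand≤∑ : ∀ {n} {g : Cube n → Carrier} → (∀ x → 0# ≤ g x) → ∀ x → g x ≤ ∑ g
  summand≤∑ {g = g} 0≤g x = begin
    g x                                                   ≈⟨ ∑-singleton x (g x) ⟨
    ∑ (λ y → if does (≡-dec _≟ᵇ_ y x) then g x else 0#)  ≤⟨ ∑-mono below ⟩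
    ∑ g                                                   ∎
    where
    below : ∀ y → (if does (≡-dec _≟ᵇ_ y x) then g x else 0#) ≤ g y
    below y with ≡-dec _≟ᵇ_ y x
    ... | yes ≡.refl = ≤-refl
    ... | no  _      = 0≤g y


-- Uniform distributions and the corruption at a point.

module _ {c ℓ₁ ℓ₂} (F : OrderedField c ℓ₁ ℓ₂) where
  open OrderedField F
  open QueryComplexity F
  open OrderedFieldProperties F
  open SumProperties F
  open PosetReasoning poset

  -- The weight `v` is the inverse of the summed indicator, so the support is never counted. Later
  -- arguments see only that `v` is positive and how the mass depends on it.
  uniform : ∀ {n p} {G : Pred (Cube n) p} → (G? : Decidable G) → (∃[ x ] G x) →
            ∃[ ν ] ∃[ v ] 0# < v × (∀ y → mass ν y ≡ (if does (G? y) then v else 0#))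
  uniform {n} G? (x , Gx) = ν , v , inv-pos 0≤W 0≉W , λ _ → ≡.refl
    where
    indicator : Cube n → Carrier
    indicator y = if does (G? y) then 1# else 0#

    0<W : 0# < ∑ indicator
    0<W = <-≤-trans (0≤1 , 0≉1) (≤-trans
      (≤-reflexive (reflexive (cong (if_then 1# else 0#) (≡.sym (dec-true (G? x) Gx)))))
      (summand≤∑ (λ y → if-nonNeg (does (G? y)) 0≤1) x))

    0≤W = proj₁ 0<W
    0≉W = proj₂ 0<W

    v : Carrier
    v = inv (∑ indicator) 0≉W

    scale : ∀ b → (if b then v else 0#) ≈ (if b then 1# else 0#) * v
    scale true  = sym (*-identityˡ v)
    scale false = sym (zeroˡ v)

    ν : Distribution n
    ν = record
      { mass   = λ y → if does (G? y) then v else 0#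
      ; nonNeg = λ y → if-nonNeg (does (G? y)) (inv-nonNeg 0≤W 0≉W)
      ; total  = begin-equality
          ∑ (λ y → if does (G? y) then v else 0#) ≈⟨ ∑-cong (scale ∘ does ∘ G?) ⟩
          ∑ (λ y → indicator y * v)               ≈⟨ ∑-distribʳ-* indicator v ⟩
          ∑ indicator * v                         ≈⟨ *-inverseʳ _ 0≉W ⟩
          1#                                      ∎
      }

  module HardDistribution {n} (f : Cube n → Bool) (x : Cube n) where

    x? : Decidable (_≡ x)
    x? y = ≡-dec _≟ᵇ_ y x

    -- In this form the event is, definitionally, the error event in `IsCertificate` for the value
    -- `f x`.
    err? : Decidable λ y → f y ≢ f x
    err? y = ¬? (f y ≟ᵇ f x)

    hard : ∃[ ν ] ∃[ v ] 0# < v ×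
           (∀ y → mass ν y ≡ (if does (x? y ⊎-dec err? y) then v else 0#))
    hard = uniform (λ y → x? y ⊎-dec err? y) (x , inj₁ ≡.refl)

    ν = proj₁ hard
    v = proj₁ (proj₂ hard)
    0<v = proj₁ (proj₂ (proj₂ hard))
    0≤v = proj₁ 0<v

    mass-≡ : ∀ y → mass ν y ≡ (if does (x? y ⊎-dec err? y) then v else 0#)
    mass-≡ = proj₂ (proj₂ (proj₂ hard))

    Exact : Assignment n → Set
    Exact A = x ∈ A × (∀ y → y ∈ A → f y ≡ f x)

    term-nonNeg : ∀ {p} {E : Pred (Cube n) p} (E? : Decidable E) y →
                0# ≤ (if does (E? y) then mass ν y else 0#)
    term-nonNeg E? y = if-nonNeg (does (E? y)) (nonNeg ν y)

    -- A single support point in the event suffices, as each carries mass `v`. At `x` this makes the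
    -- probability of a subcube positive; at an error point it bounds the error mass from below.
    v≤Pr : ∀ {p} {E : Pred (Cube n) p} (E? : Decidable E) y → E y →
           y ≡ x ⊎ f y ≢ f x → v ≤ Pr ν E?
    v≤Pr E? y Ey supp = begin
      v                                       ≡⟨ cong (if_then v else 0#) (dec-true (x? y ⊎-dec err? y) supp) ⟨
      (if does (x? y ⊎-dec err? y) then v else 0#) ≡⟨ mass-≡ y ⟨
      mass ν y                                ≡⟨ cong (if_then mass ν y else 0#) (dec-true (E? y) Ey) ⟨
      (if does (E? y) then mass ν y else 0#)  ≤⟨ summand≤∑ (term-nonNeg E?) y ⟩
      Pr ν E?                                 ∎

    module _ {ε : Carrier} (0≤ε : 0# ≤ ε) (2ε<1 : 2 · ε < 1#) where

      exact⇒certificate : ∀ A → Exact A → IsCertificate f ε (f x) ν A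
      exact⇒certificate A (x∈A , exact) = pos , (begin
        Pr ν (λ y → err? y ×-dec (y ∈? A)) * inv (Pr ν (_∈? A)) (proj₂ pos) ≈⟨ *-congʳ (∑-zero no-error) ⟩
        0# * inv (Pr ν (_∈? A)) (proj₂ pos) ≈⟨ zeroˡ _ ⟩
        0#                                  ≤⟨ 0≤ε ⟩
        ε                                   ∎)
        where
        pos : 0# < Pr ν (_∈? A)
        pos = <-≤-trans 0<v (v≤Pr (_∈? A) x x∈A (inj₁ ≡.refl))

        no-error : ∀ y → (if does (err? y ×-dec (y ∈? A)) then mass ν y else 0#) ≈ 0#
        no-error y = if-≈0 (err? y ×-dec (y ∈? A)) λ
          { (fy≢fx , y∈A) → contradiction (exact y y∈A) fy≢fx }

      certificate⇒exact : ∀ A → IsCertificate f ε (f x) ν A → Exact A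
      certificate⇒exact A (pos , error≤ε) =
        -- Constancy is proved independently of `x ∈ A`. Given it, a subcube missing `x` contains no
        -- support point and would have probability zero.
        decidable-stable (x ∈? A) (λ x∉A → proj₂ pos (sym (∑-zero (no-mass x∉A)))) , constant
        where
        p q i : Carrier
        p = Pr ν (_∈? A)
        q = Pr ν (λ y → err? y ×-dec (y ∈? A))
        i = inv p (proj₂ pos)

        -- `a`, `e` and `d` stand for `y ∈ A`, `y` being an error point, and `y ≡ x`. A support
        -- point in `A` is an error point or `x` itself, which is the pointwise form of `p ≤ q + v`.
        split : ∀ a e d → (if a then (if d ∨ e then v else 0#) else 0#) ≤
                (if e ∧ a then (if d ∨ e then v else 0#) else 0#) + (if d then v else 0#)
        split false e     d     = ≤-trans (if-nonNeg d 0≤v) (x≤y+x (if-nonNeg (e ∧ false) (if-nonNeg (d ∨ e) 0≤v)))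
        split true  true  d     = x≤x+y (if-nonNeg d 0≤v)
        split true  false true  = x≤y+x ≤-refl
        split true  false false = x≤y+x ≤-refl

        p≤q+v : p ≤ q + v
        p≤q+v = begin
          p ≤⟨ ∑-mono below ⟩
          ∑ (λ y → g y + h y) ≈⟨ ∑-distrib-+ g h ⟩
          q + ∑ h             ≈⟨ +-congˡ (∑-singleton x v) ⟩
          q + v               ∎
          where
          g h : Cube n → Carrier
          g y = if does (err? y ×-dec (y ∈? A)) then mass ν y else 0#
          h y = if does (x? y) then v else 0#

          below : ∀ y → (if does (y ∈? A) then mass ν y else 0#) ≤ g y + h y
          below y rewrite mass-≡ y = split (does (y ∈? A)) (does (err? y)) (does (x? y))

        constant : ∀ y → y ∈ A → f y ≡ f x
        -- One error point in `A` gives `v ≤ q`, so `p ≤ q + q`. Dividing by `p`, the conditional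
        -- error is at least one half, against `2 · ε < 1#`.
        constant y y∈A = decidable-stable (f y ≟ᵇ f x) λ fy≢fx → <⇒≱ 2ε<1 (begin
          1#            ≈⟨ *-inverseʳ p (proj₂ pos) ⟨
          p * i         ≤⟨ *-monoʳ-≤ (inv-nonNeg (proj₁ pos) (proj₂ pos)) (≤-trans p≤q+v (+-monoʳ-≤ q
                             (v≤Pr (λ y → err? y ×-dec (y ∈? A)) y (fy≢fx , y∈A) (inj₂ fy≢fx)))) ⟩
          (q + q) * i   ≈⟨ distribʳ i q q ⟩
          q * i + q * i ≤⟨ +-mono-≤ error≤ε error≤ε ⟩
          ε + ε         ≈⟨ x+x≈2·x ε ⟩
          2 · ε         ∎)

        no-mass : ¬ x ∈ A → ∀ y → (if does (y ∈? A) then mass ν y else 0#) ≈ 0#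
        no-mass x∉A y = if-≈0 (y ∈? A) λ y∈A → trans (reflexive (mass-≡ y))
          (if-≈0 (x? y ⊎-dec err? y) λ
            { (inj₁ ≡.refl) → contradiction y∈A x∉A
            ; (inj₂ fy≢fx)  → contradiction (constant y y∈A) fy≢fx })

      -- A smallest certifying set is taken because `IsCorr` bounds only attained minima. One
      -- direction of the equivalence with `Exact` makes `restrict x S` a certificate; the other
      -- turns any competing certificate into a certifying set, no smaller than `S`.
      corruption-at : ∃[ S ] Certifies f S x × IsCorrAt f ε (f x) ν ∣ S ∣
      corruption-at with min-subset (certifies? f x) (⊤ , ⊤-certifies f x)
      ... | S , cert , minimal = S , cert ,
        (restrict x S ,
         exact⇒certificate (restrict x S)
           (∈-restrict⁺ x x S (λ _ _ → ≡.refl) , λ y y∈ → cert y (∈-restrict⁻ x y S y∈)) ,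
         codim-restrict x S) ,
        λ { _ (A , certA , ≡.refl) →
          let x∈A , exact = certificate⇒exact A certA
          in ℕₚ.≤-trans
               (minimal (support A) λ y y≈x → exact y (∈-resp-support x y A x∈A y≈x))
               (ℕₚ.≤-reflexive (∣support∣ A)) }

  -- From corruption to distributional query complexity.

  correct⇒Pr≈1 : ∀ {n} (f : Cube n → Bool) t (μ : Distribution n) →
                 (∀ x → run t x ≡ f x) → Pr μ (λ x → run t x ≟ᵇ f x) ≈ 1#
  correct⇒Pr≈1 f t μ correct = trans
    (∑-cong λ x → reflexive (cong (if_then mass μ x else 0#)
      (dec-true (run t x ≟ᵇ f x) (correct x))))
    (total μ)

theorem17 : ∀ {c ℓ₁ ℓ₂} →
  Σ[ K ∈ ℕ ] 0 ℕ.< K ×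
    ((F : OrderedField c ℓ₁ ℓ₂) →
     let open OrderedField F
         open QueryComplexity F in
     (n : ℕ) → 1 ℕ.≤ n →
     (f : Cube n → Bool) →
     (ε : Carrier) → 0# ≤ ε → 2 · ε < 1# →
     (μ : Distribution n) → IsProduct μ →
     (d k : ℕ) → IsD f μ (4 · ε) d → IsCorr f ε k →
     d ℕ.≤ K ℕ.* k ℕ.^ 2)
theorem17 = 1 , s≤s z≤n , λ F n _ f ε 0≤ε 2ε<1 μ _ d k (_ , d-min) (_ , k-max) →
  let open OrderedField F
      open OrderedFieldProperties F
      certs = λ x →
        let open HardDistribution F f x
            S , cert , corr = corruption-at 0≤ε 2ε<1
        -- The pair of `ν` and `f x` built from `x` competes in the maximum, so `k` bounds the size
        -- of `S`.
        in S , k-max ∣ S ∣ (ν , f x , corr) , cert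
      t , correct , wc≤k² = certificates⇒tree f certs
      -- The tree is correct on every input, so its success probability is `1#`, which is at least
      -- `1# - 4 · ε`.
      accurate = ≤-trans (x-y≤x (·-nonNeg 4 0≤ε))
                         (≤-reflexive (sym (correct⇒Pr≈1 F f t μ correct)))
  in ℕₚ.≤-trans (d-min (worstCase t) (t , accurate , ≡.refl))
       (ℕₚ.≤-trans wc≤k² (ℕₚ.≤-reflexive
         (≡.sym (≡.trans (ℕₚ.*-identityˡ (k ℕ.^ 2)) (cong (k ℕ.*_) (ℕₚ.*-identityʳ k))))))
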